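{- Let $r\ge1$ and let $\mu=\langle\mu_1,\dots,\mu_{r+1}\rangle\in\mathbb{Z}^{r+1}$ with $\mu_1+\cdots+\mu_{r+1}=0$. Then the map of the previous theorem (juggling sequence $\mapsto$ multiset of roots $\varepsilon_i-\varepsilon_{i+j}$, one for each throw at time $i$ to height $j$) is a bijection between $\mathrm{JS}(\langle\mu_1,\dots,\mu_r\rangle,\langle\mu_1+\cdots+\mu_r\rangle,r)$ and $P_{A_r}(\mu)$; in particular \[K_{A_r}(\mu)=\mathsf{js}(\langle\mu_1,\dots,\mu_r\rangle,\langle\mu_1+\cdots+\mu_r\rangle,r).\]
   Context: A (magic) juggling state is a finitely supported integer vector $\mathbf{s}=\langle s_1,s_2,\dots\rangle$ indexed by heights $1,2,\dots$ (trailing zeros omitted). A juggling sequence of length $n$ from $\mathbf{a}$ to $\mathbf{b}$ is a sequence $(\mathbf{s}_0,\dots,\mathbf{s}_n)$ with $\mathbf{s}_0=\mathbf{a}$, $\mathbf{s}_n=\mathbf{b}$, such that for each $1\le i\le n$ there are nonnegative integers $c^{(i)}_1,c^{(i)}_2,\dots$ (finitely many nonzero) with $\sum_k c^{(i)}_k=(\mathbf{s}_{i-1})_1$ and $(\mathbf{s}_i)_k=(\mathbf{s}_{i-1})_{k+1}+c^{(i)}_k$ for all $k\ge1$; $c^{(i)}_j$ is the number of throws at time $i$ to height $j$. $\mathrm{JS}(\mathbf{a},\mathbf{b},n)$ is the set of these, $\mathsf{js}(\mathbf{a},\mathbf{b},n)$ its cardinality. $\varepsilon_1,\dots,\varepsilon_{r+1}$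 is the standard basis of $\mathbb{R}^{r+1}$, $\Phi^+_{A_r}=\{\varepsilon_i-\varepsilon_j:1\le i<j\le r+1\}$, $P_{A_r}(\mu)$ is the set of finite multisets of elements of $\Phi^+_{A_r}$ summing to $\mu$ (empty multiset allowed for $\mu=0$), and $K_{A_r}(\mu)=|P_{A_r}(\mu)|$. -}

module Defs where

open import Level using (0ℓ)
open import Data.Nat.Base as ℕ using (ℕ; zero; suc; _≤_; z≤n; s≤s)
open import Data.Integer.Base as ℤ using (ℤ; +_; 0ℤ; 1ℤ)
open import Data.Bool.Base using (if_then_else_)
open import Data.Fin.Base as Fin using (Fin; toℕ; inject₁; fromℕ)
open import Data.List.Base as List using (List; concatMap; applyUpTo; allFin)
open import Data.List.Relation.Unary.All using (All)
import Data.List.Relation.Binary.Permutation.Propositional as Perm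
open import Data.Vec.Base as Vec using (Vec; []; _∷_)
open import Data.Vec.Functional using (Vector)
import Data.Vec.Functional.Relation.Binary.Equality.Setoid as PointwiseEq
open import Data.Product.Base using (∃₂; _×_)
open import Function.Bundles using (Bijection)
open import Relation.Binary.Bundles using (Setoid)
import Relation.Binary.Construct.On as On
open import Relation.Binary.PropositionalEquality
  using (_≡_; refl; setoid; _→-setoid_)

HasCardinality : Setoid 0ℓ 0ℓ → ℕ → Set
HasCardinality S m = Bijection (setoid (Fin m)) S

-- Heights start at 1: index k stands for height k + 1.
record FinSupp {A : Set} (0# : A) : Set where
  field
    at     : ℕ → A
    bound  : ℕ
    vanish : ∀ k → bound ≤ k → at k ≡ 0#

open FinSupp public

State : Set
State = FinSupp 0ℤ

-- The choice of bound is irrelevant to equality.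
stateSetoid : Setoid 0ℓ 0ℓ
stateSetoid = On.setoid {B = State} (ℕ →-setoid ℤ) at

open Setoid stateSetoid public using () renaming (_≈_ to _≈ₛ_)

entry : ∀ {m} → Vec ℤ m → ℕ → ℤ
entry []       _       = 0ℤ
entry (x ∷ xs) zero    = x
entry (x ∷ xs) (suc k) = entry xs k

entry-vanish : ∀ {m} (xs : Vec ℤ m) k → m ≤ k → entry xs k ≡ 0ℤ
entry-vanish []       k       z≤n     = refl
entry-vanish (x ∷ xs) (suc k) (s≤s p) = entry-vanish xs k p

⟨_⟩ : ∀ {m} → Vec ℤ m → State
⟨_⟩ {m} xs = record { at = entry xs ; bound = m ; vanish = entry-vanish xs }

Throws : Set
Throws = FinSupp 0

total : Throws → ℕ
total c = List.sum (applyUpTo (at c) (bound c))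

-- Index i : Fin n stands for time i + 1, so its throws lead from s_i to s_{i+1}.
record JugglingSequence (a b : State) (n : ℕ) : Set where
  field
    states : Vector State (suc n)
    start  : states Fin.zero ≈ₛ a
    end    : states (fromℕ n) ≈ₛ b
    throws : Fin n → Throws
    caught : ∀ i → + total (throws i) ≡ at (states (inject₁ i)) 0
    step   : ∀ i k → at (states (Fin.suc i)) k
                       ≡ at (states (inject₁ i)) (suc k) ℤ.+ + at (throws i) k

open JugglingSequence public

-- A juggling sequence is its sequence of states, so only these are compared;
-- by step they determine the number of throws to each height.
JS : State → State → ℕ → Setoid 0ℓ 0ℓ
JS a b n = On.setoid {B = JugglingSequence a b n}
             (PointwiseEq.≋-setoid stateSetoid (suc n)) states

_⊕_ _⊖_ : ∀ {d} → Vec ℤ d → Vec ℤ d → Vec ℤ d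
_⊕_ = Vec.zipWith ℤ._+_
_⊖_ = Vec.zipWith ℤ._-_

sumℤ : ∀ {d} → Vec ℤ d → ℤ
sumℤ = Vec.foldr _ ℤ._+_ 0ℤ

-- Zero-based: ε i is the basis vector ε_{i+1} if i < d, and the zero vector
-- otherwise.
ε : ∀ {d} → ℕ → Vec ℤ d
ε i = Vec.tabulate λ k → if toℕ k ℕ.≡ᵇ i then 1ℤ else 0ℤ

IsPositiveRoot : ∀ r → Vec ℤ (suc r) → Set
IsPositiveRoot r v =
  ∃₂ λ (i j : Fin (suc r)) → i Fin.< j × v ≡ ε (toℕ i) ⊖ ε (toℕ j)

record RootMultiset (r : ℕ) (μ : Vec ℤ (suc r)) : Set where
  field
    roots    : List (Vec ℤ (suc r))
    positive : All (IsPositiveRoot r) roots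
    sums     : List.foldr _⊕_ (Vec.replicate (suc r) 0ℤ) roots ≡ μ

open RootMultiset public

open Perm public using (_↭_)

-- Multisets are lists up to permutation.
P : ∀ r → Vec ℤ (suc r) → Setoid 0ℓ 0ℓ
P r μ = On.setoid {B = RootMultiset r μ} Perm.↭-setoid roots

-- One vector ε_t - ε_{t+h} for each throw at time t = i + 1 to height h = j + 1.
-- If t ≤ d < t + h, this vector is ε_t, which is not a positive root.
throwRoots : ∀ d {a b n} → JugglingSequence a b n → List (Vec ℤ d)
throwRoots d {n = n} s =
  concatMap (λ i → List.concat (applyUpTo (λ j →
      List.replicate (at (throws s i) j) (ε (toℕ i) ⊖ ε (toℕ i ℕ.+ suc j)))
      (bound (throws s i))))
    (allFin n)

K[_,_]≡_ : ∀ r → Vec ℤ (suc r) → ℕ → Set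
K[ r , μ ]≡ m = HasCardinality (P r μ) m

js[_,_,_]≡_ : State → State → ℕ → ℕ → Set
js[ a , b , n ]≡ m = HasCardinality (JS a b n) m

{-# OPTIONS --safe #-}

-- In the sum of the roots of a juggling sequence, coordinate q is the number of
-- balls thrown at time q minus the number of throws landing at time q. For q ≤ r
-- the juggling rules say exactly that this equals μ_q; the final state says the
-- same for q = r + 1 and forbids later landings. So the numbers of throws to
-- each height are exactly the multiplicities of the root multisets, and they
-- determine the states. Finiteness holds because every root ε_i - ε_j has height
-- j - i ≥ 1, so the height of μ bounds the number of roots in a multiset.

module Submission where

open import Defs
open import Data.Nat.Base as ℕ using (ℕ; zero; suc; _≤_; _<_; z≤n; s≤s; _⊔_)
import Data.Nat.ListAction as ListAction
import Data.Nat.Properties as ℕₚ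
open import Data.Integer.Base as ℤ using (ℤ; +_; 0ℤ; 1ℤ; ∣_∣)
import Data.Integer.Properties as ℤₚ
open import Algebra.Properties.AbelianGroup ℤₚ.+-0-abelianGroup
  using () renaming (∙-cancelˡ to +-cancelˡ)
open import Algebra.Properties.CommutativeMonoid.Sum ℤₚ.+-0-commutativeMonoid
  using (sum; sum-cong-≗; ∑-distrib-+; sum-replicate-zero)
open import Data.Integer.Tactic.RingSolver using (solve-∀)
open import Data.Bool.Base using (true; false; if_then_else_)
open import Data.Fin.Base as Fin using (Fin; toℕ; inject₁; fromℕ; fromℕ<)
import Data.Fin.Properties as Finₚ
open import Data.List.Base as List
  using (List; []; _∷_; _++_; concat; concatMap; applyUpTo; allFin; length;
         mapMaybe; deduplicate; cartesianProductWith)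
open import Data.List.Membership.Propositional using (_∈_)
open import Data.List.Membership.Propositional.Properties
  using (∈-∃++; ∈-allFin; ∈-lookup; ∈-cartesianProductWith⁺)
open import Data.List.Relation.Unary.All as All using (All; []; _∷_)
import Data.List.Relation.Unary.All.Properties as Allₚ
open import Data.List.Relation.Unary.AllPairs using (_∷_)
open import Data.List.Relation.Unary.Any as Any using (Any; here; there)
import Data.List.Relation.Unary.Any.Properties as Anyₚ
open import Data.List.Relation.Unary.Enumerates.Setoid using (IsEnumeration)
open import Data.List.Relation.Unary.Enumerates.Setoid.Properties
  using (deduplicate⁺; lookup-surjective)
open import Data.List.Relation.Unary.Unique.Setoid using (Unique)
open import Data.List.Relation.Unary.Unique.DecSetoid.Properties using (deduplicate-!)
open import Data.List.Relation.Binary.Permutation.Propositional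
  using (refl; prep; swap; trans; ↭-refl; ↭-sym; ↭-trans)
open import Data.List.Relation.Binary.Permutation.Propositional.Properties
  using (shift; drop-∷; ∈-resp-↭; All-resp-↭)
open import Data.Maybe.Base using (Maybe; just; nothing)
open import Data.Maybe.Relation.Unary.Any as MAny using (just)
open import Data.Vec.Base as Vec using (Vec; []; _∷_; init; lookup)
import Data.Vec.Properties as Vecₚ
open import Data.Vec.Functional using (Vector)
open import Data.Vec.Relation.Binary.Pointwise.Extensional using (ext; Pointwise-≡⇒≡)
open import Data.Product.Base using (Σ; _×_; _,_; proj₁; proj₂; ∃-syntax)
open import Data.Sum.Base using (inj₁; inj₂)
open import Function.Base using (_∘_; id)
open import Function.Bundles using (Bijection)
import Function.Properties.Bijection as Bijectionₚ
import Function.Properties.Inverse as Inverseₚ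
open import Level using (0ℓ)
open import Relation.Binary.Bundles using (Setoid; DecSetoid)
open import Relation.Binary.Definitions using (DecidableEquality; Decidable)
open import Relation.Binary.PropositionalEquality as ≡
  using (_≡_; _≢_; _≗_; refl; sym; cong; cong₂; subst; module ≡-Reasoning)
open import Relation.Nullary using (¬_; Dec; yes; no; does; contradiction; _×-dec_)
open import Relation.Nullary.Decidable using (map′)

open ≡-Reasoning

-- Sums of integers over Fin

sum-zero : ∀ {n} {f : Vector ℤ n} → (∀ i → f i ≡ 0ℤ) → sum f ≡ 0ℤ
sum-zero {n} f≡0 = ≡.trans (sum-cong-≗ f≡0) (sum-replicate-zero n)

sum-single : ∀ {n} {f : Vector ℤ n} i → (∀ j → j ≢ i → f j ≡ 0ℤ) → sum f ≡ f i
sum-single {f = f} Fin.zero f≡0 =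
  ≡.trans (cong (ℤ._+_ (f Fin.zero)) (sum-zero λ j → f≡0 (Fin.suc j) λ ())) (ℤₚ.+-identityʳ _)
sum-single (Fin.suc i) f≡0 =
  ≡.trans (cong₂ ℤ._+_ (f≡0 Fin.zero λ ())
            (sum-single i λ j j≢i → f≡0 (Fin.suc j) (j≢i ∘ Finₚ.suc-injective)))
          (ℤₚ.+-identityˡ _)

-- Sums over heights are cut off at `bound c`, while the height of interest is any natural number.
-- Past the cut-off its term vanishes, so the truncation is harmless.
sum-single-toℕ : ∀ {n} (f : ℕ → ℤ) k → (∀ j → j ≢ k → f j ≡ 0ℤ) →
                 (n ≤ k → f k ≡ 0ℤ) → sum {n} (f ∘ toℕ) ≡ f k
sum-single-toℕ {n} f k f≡0 fk≡0 with k ℕₚ.<? n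
... | yes k<n = ≡.trans
  (sum-single (fromℕ< k<n) λ j j≢k → f≡0 (toℕ j) λ eq →
    j≢k (Finₚ.toℕ-injective (≡.trans eq (sym (Finₚ.toℕ-fromℕ< k<n)))))
  (cong f (Finₚ.toℕ-fromℕ< k<n))
... | no k≮n = ≡.trans (sum-zero all≡0) (sym (fk≡0 n≤k))
  where
  n≤k = ℕₚ.≮⇒≥ k≮n
  all≡0 : ∀ (j : Fin n) → f (toℕ j) ≡ 0ℤ
  all≡0 j = f≡0 (toℕ j) (ℕₚ.<⇒≢ (ℕₚ.<-≤-trans (Finₚ.toℕ<n j) n≤k))

-- Weights of lists

-- Coordinates of a sum of roots and multiplicities of roots are both weights, so the double sum
-- over times and heights is worked out once for both.
weight : {A : Set} → (A → ℤ) → List A → ℤ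
weight w []       = 0ℤ
weight w (x ∷ xs) = w x ℤ.+ weight w xs

module _ {A : Set} (w : A → ℤ) where

  weight-++ : ∀ xs ys → weight w (xs ++ ys) ≡ weight w xs ℤ.+ weight w ys
  weight-++ []       ys = sym (ℤₚ.+-identityˡ _)
  weight-++ (x ∷ xs) ys =
    ≡.trans (cong (λ z → w x ℤ.+ z) (weight-++ xs ys)) (sym (ℤₚ.+-assoc (w x) _ _))

  weight-↭ : ∀ {xs ys} → xs ↭ ys → weight w xs ≡ weight w ys
  weight-↭ refl = refl
  weight-↭ (prep x p) = cong (λ z → w x ℤ.+ z) (weight-↭ p)
  weight-↭ (swap x y p) rewrite weight-↭ p = lemma (w x) (w y) _
    where
    lemma : ∀ a b c → a ℤ.+ (b ℤ.+ c) ≡ b ℤ.+ (a ℤ.+ c)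
    lemma = solve-∀
  weight-↭ (trans p q) = ≡.trans (weight-↭ p) (weight-↭ q)

  weight-replicate : ∀ n x → weight w (List.replicate n x) ≡ + n ℤ.* w x
  weight-replicate zero    x = sym (ℤₚ.*-zeroˡ (w x))
  weight-replicate (suc n) x =
    ≡.trans (cong (λ z → w x ℤ.+ z) (weight-replicate n x)) (sym (ℤₚ.suc-* (+ n) (w x)))

  weight-concat-applyUpTo : ∀ f b →
    weight w (concat (applyUpTo f b)) ≡ sum {b} (weight w ∘ f ∘ toℕ)
  weight-concat-applyUpTo f zero    = refl
  weight-concat-applyUpTo f (suc b) = ≡.trans (weight-++ (f 0) _)
    (cong (λ z → weight w (f 0) ℤ.+ z) (weight-concat-applyUpTo (f ∘ suc) b))

  weight-concatMap-tabulate : ∀ {B : Set} (f : B → List A) {n} (g : Fin n → B) →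
    weight w (concatMap f (List.tabulate g)) ≡ sum (weight w ∘ f ∘ g)
  weight-concatMap-tabulate f {zero}  g = refl
  weight-concatMap-tabulate f {suc n} g = ≡.trans (weight-++ (f (g Fin.zero)) _)
    (cong (λ z → weight w (f (g Fin.zero)) ℤ.+ z)
          (weight-concatMap-tabulate f (g ∘ Fin.suc)))

-- Multiplicities and permutations

∈⇒↭∷ : ∀ {A : Set} {x : A} {ys} → x ∈ ys → ∃[ zs ] (ys ↭ x ∷ zs)
∈⇒↭∷ x∈ys with as , bs , refl ← ∈-∃++ x∈ys = as ++ bs , shift _ as bs

module _ {A : Set} (_≟_ : DecidableEquality A) where

  indicator : A → A → ℕ
  indicator x y = if does (x ≟ y) then 1 else 0

  indicator-refl : ∀ x → indicator x x ≡ 1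
  indicator-refl x with x ≟ x
  ... | yes _  = refl
  ... | no x≢x = contradiction refl x≢x

  indicator-≢ : ∀ {x y} → x ≢ y → indicator x y ≡ 0
  indicator-≢ {x} {y} x≢y with x ≟ y
  ... | yes x≡y = contradiction x≡y x≢y
  ... | no _    = refl

  count : A → List A → ℕ
  count x []       = 0
  count x (y ∷ ys) = indicator x y ℕ.+ count x ys

  +count≡weight : ∀ x xs → + count x xs ≡ weight (+_ ∘ indicator x) xs
  +count≡weight x []       = refl
  +count≡weight x (y ∷ ys) =
    ≡.trans (ℤₚ.pos-+ (indicator x y) (count x ys))
            (cong (λ z → + indicator x y ℤ.+ z) (+count≡weight x ys))

  count-↭ : ∀ x {xs ys} → xs ↭ ys → count x xs ≡ count x ys
  count-↭ x {xs} {ys} p = ℤₚ.+-injective (begin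
    + count x xs                  ≡⟨ +count≡weight x xs ⟩
    weight (+_ ∘ indicator x) xs  ≡⟨ weight-↭ _ p ⟩
    weight (+_ ∘ indicator x) ys  ≡⟨ +count≡weight x ys ⟨
    + count x ys                  ∎)

  count≢0⇒∈ : ∀ x ys → count x ys ≢ 0 → x ∈ ys
  count≢0⇒∈ x []       ≢0 = contradiction refl ≢0
  count≢0⇒∈ x (y ∷ ys) ≢0 with x ≟ y
  ... | yes x≡y = here x≡y
  ... | no  _   = there (count≢0⇒∈ x ys ≢0)

  count-All : ∀ {P : A → Set} {x} → ¬ P x → ∀ {ys} → All P ys → count x ys ≡ 0
  count-All ¬px []         = refl
  count-All {P} ¬px (py ∷ pys) =
    cong₂ ℕ._+_ (indicator-≢ λ x≡y → ¬px (subst P (sym x≡y) py)) (count-All ¬px pys)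

  -- The head of `xs` has nonzero count in `ys`, so it can be moved to the front of `ys` and
  -- cancelled. With positivity as `P`, only the counts of positive roots have to be compared.
  count⇒↭ : ∀ {P : A → Set} {xs ys} → All P xs → All P ys →
            (∀ x → P x → count x xs ≡ count x ys) → xs ↭ ys
  count⇒↭ {ys = []} [] [] _ = refl
  count⇒↭ {ys = y ∷ ys} [] (py ∷ _) eq
    with () ← ≡.trans (eq y py) (cong (ℕ._+ count y ys) (indicator-refl y))
  count⇒↭ {P} {x ∷ xs} {ys} (px ∷ pxs) pys eq
    with zs , ys↭ ← ∈⇒↭∷ (count≢0⇒∈ x ys λ ≡0 → ℕₚ.0≢1+n (≡.trans (sym ≡0)
           (≡.trans (sym (eq x px)) (cong (ℕ._+ count x xs) (indicator-refl x)))))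
    = ↭-trans (prep x (count⇒↭ pxs (All.tail (All-resp-↭ ys↭ pys)) λ v pv →
        ℕₚ.+-cancelˡ-≡ (indicator v x) _ _ (≡.trans (eq v pv) (count-↭ v ys↭))))
      (↭-sym ys↭)

  -- It does not matter which occurrence of the head is removed from `ys`: by `drop-∷` a permutation
  -- survives the cancellation.
  _↭?_ : Decidable (_↭_ {A = A})
  [] ↭? [] = yes refl
  [] ↭? (y ∷ ys) = no λ p → contradiction (∈-resp-↭ (↭-sym p) (here refl)) λ ()
  (x ∷ xs) ↭? ys with Any.any? (x ≟_) ys
  ... | no x∉ys = no λ p → x∉ys (∈-resp-↭ p (here refl))
  ... | yes x∈ys with zs , ys↭ ← ∈⇒↭∷ x∈ys =
    map′ (λ p → ↭-trans (prep x p) (↭-sym ys↭))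
         (λ p → drop-∷ (↭-trans p ys↭))
         (xs ↭? zs)

-- Coordinates of roots

-- Written with the Boolean test of `ε`, so that it agrees with the coordinates of `ε` by
-- computation and is definitionally invariant under shifting both indices by one.
δ : ℕ → ℕ → ℤ
δ m n = if m ℕ.≡ᵇ n then 1ℤ else 0ℤ

δ-refl : ∀ n → δ n n ≡ 1ℤ
δ-refl zero    = refl
δ-refl (suc n) = δ-refl n

δ-≢ : ∀ {m n} → m ≢ n → δ m n ≡ 0ℤ
δ-≢ {zero}  {zero}  m≢n = contradiction refl m≢n
δ-≢ {zero}  {suc n} m≢n = refl
δ-≢ {suc m} {zero}  m≢n = refl
δ-≢ {suc m} {suc n} m≢n = δ-≢ (m≢n ∘ cong suc)

1≢-δ : ∀ m n → 1ℤ ≢ 0ℤ ℤ.- δ m n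
1≢-δ m n with m ℕ.≡ᵇ n
... | true  = λ ()
... | false = λ ()

-1≢δ : ∀ m n → ℤ.- 1ℤ ≢ δ m n ℤ.- 0ℤ
-1≢δ m n with m ℕ.≡ᵇ n
... | true  = λ ()
... | false = λ ()

root : ∀ {d} → ℕ → ℕ → Vec ℤ d
root i j = ε i ⊖ ε j

lookup-root : ∀ {d} (q : Fin d) i j →
              lookup (root i j) q ≡ δ (toℕ q) i ℤ.- δ (toℕ q) j
lookup-root q i j = ≡.trans (Vecₚ.lookup-zipWith ℤ._-_ q (ε i) (ε j))
  (cong₂ ℤ._-_ (Vecₚ.lookup∘tabulate _ q) (Vecₚ.lookup∘tabulate _ q))

-- An entry 1 can only come from `ε i′` and an entry -1 only from `ε j′`; the entries at `i` and `j`
-- are such. As `i′` and `j′` are arbitrary naturals, this also excludes indices beyond the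
-- dimension.
root-injective : ∀ {d} (i j : Fin d) {i′ j′} → i Fin.< j →
                 root {d} (toℕ i) (toℕ j) ≡ root i′ j′ → toℕ i ≡ i′ × toℕ j ≡ j′
root-injective i j {i′} {j′} i<j eq = i≡ , j≡
  where
  coordinate : ∀ q → δ (toℕ q) (toℕ i) ℤ.- δ (toℕ q) (toℕ j)
                   ≡ δ (toℕ q) i′ ℤ.- δ (toℕ q) j′
  coordinate q = ≡.trans (sym (lookup-root q (toℕ i) (toℕ j)))
    (≡.trans (cong (λ v → lookup v q) eq) (lookup-root q i′ j′))

  at-i : 1ℤ ≡ δ (toℕ i) i′ ℤ.- δ (toℕ i) j′
  at-i = ≡.trans (sym (cong₂ ℤ._-_ (δ-refl (toℕ i)) (δ-≢ (ℕₚ.<⇒≢ i<j))))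
                 (coordinate i)

  at-j : ℤ.- 1ℤ ≡ δ (toℕ j) i′ ℤ.- δ (toℕ j) j′
  at-j = ≡.trans (sym (cong₂ ℤ._-_ (δ-≢ (ℕₚ.>⇒≢ i<j)) (δ-refl (toℕ j))))
                 (coordinate j)

  i≡ : toℕ i ≡ i′
  i≡ with toℕ i ℕₚ.≟ i′
  ... | yes p = p
  ... | no i≢i′ = contradiction
    (≡.trans at-i (cong (λ z → z ℤ.- δ (toℕ i) j′) (δ-≢ i≢i′))) (1≢-δ (toℕ i) j′)

  j≡ : toℕ j ≡ j′
  j≡ with toℕ j ℕₚ.≟ j′
  ... | yes p = p
  ... | no j≢j′ = contradiction
    (≡.trans at-j (cong (λ z → δ (toℕ j) i′ ℤ.- z) (δ-≢ j≢j′))) (-1≢δ (toℕ j) i′)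

sumV : ∀ {d} → List (Vec ℤ d) → Vec ℤ d
sumV {d} = List.foldr _⊕_ (Vec.replicate d 0ℤ)

lookup-sumV : ∀ {d} (q : Fin d) vs →
              lookup (sumV vs) q ≡ weight (λ v → lookup v q) vs
lookup-sumV q []       = Vecₚ.lookup-replicate q 0ℤ
lookup-sumV q (v ∷ vs) = ≡.trans (Vecₚ.lookup-zipWith ℤ._+_ q v (sumV vs))
  (cong (λ z → lookup v q ℤ.+ z) (lookup-sumV q vs))

lookup-ext : ∀ {A : Set} {d} {v w : Vec A d} → lookup v ≗ lookup w → v ≡ w
lookup-ext eq = Pointwise-≡⇒≡ (ext eq)

-- Net number of balls leaving at each time

-- This is coordinate `q` of the sum of the roots thrown at time `t`, as `sum-δ≡leaving` shows.
-- Recursion on both times makes `net c (suc q)` compute to a landing term plus the `net` of the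
-- tail.
leaving : ℕ → Throws → ℕ → ℤ
leaving zero    c zero    = + total c
leaving zero    c (suc k) = ℤ.- (+ at c k)
leaving (suc t) c zero    = 0ℤ
leaving (suc t) c (suc q) = leaving t c q

net : ∀ {n} → Vector Throws n → ℕ → ℤ
net c q = sum λ i → leaving (toℕ i) (c i) q

net-zero : ∀ {n} (c : Vector Throws (suc n)) → net c 0 ≡ + total (c Fin.zero)
net-zero {n} c = ≡.trans (cong (λ z → + total (c Fin.zero) ℤ.+ z)
  (sum-replicate-zero n)) (ℤₚ.+-identityʳ _)

LandsNone : ∀ {n} → Vector Throws n → ℕ → Set
LandsNone c q = ∀ i k → toℕ i ℕ.+ suc k ≡ q → at (c i) k ≡ 0

-- Throws happen only before time `n`; from then on only landings are counted, with a negative sign.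
net≤0 : ∀ {n} (c : Vector Throws n) {q} → n ≤ q → net c q ℤ.≤ 0ℤ
net≤0 {zero}  c n≤q = ℤₚ.≤-refl
net≤0 {suc n} c {suc q} (s≤s n≤q) =
  ℤₚ.+-mono-≤ (ℤₚ.neg-≤-pos {at (c Fin.zero) q}) (net≤0 (c ∘ Fin.suc) n≤q)

landsNone⇒net≡0 : ∀ {n} (c : Vector Throws n) {q} → n ≤ q → LandsNone c q → net c q ≡ 0ℤ
landsNone⇒net≡0 {zero}  c n≤q none = refl
landsNone⇒net≡0 {suc n} c {suc q} (s≤s n≤q) none =
  cong₂ (λ x y → ℤ.- (+ x) ℤ.+ y) (none Fin.zero q refl)
    (landsNone⇒net≡0 (c ∘ Fin.suc) n≤q λ i k eq → none (Fin.suc i) k (cong suc eq))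

-m+i≡0⇒m≡0 : ∀ m {i} → i ℤ.≤ 0ℤ → ℤ.- (+ m) ℤ.+ i ≡ 0ℤ → m ≡ 0
-m+i≡0⇒m≡0 m {i} i≤0 eq = ℕₚ.n≤0⇒n≡0 (ℤₚ.drop‿+≤+ (subst (ℤ._≤ 0ℤ) i≡m i≤0))
  where
  lemma : ∀ x y → y ≡ (ℤ.- x ℤ.+ y) ℤ.+ x
  lemma = solve-∀
  i≡m : i ≡ + m
  i≡m = ≡.trans (lemma (+ m) i) (≡.trans (cong (ℤ._+ + m) eq) (ℤₚ.+-identityˡ (+ m)))

-- All summands of `net` are nonpositive at such a time, so none can compensate another.
net≡0⇒landsNone : ∀ {n} (c : Vector Throws n) {q} → n ≤ q → net c q ≡ 0ℤ → LandsNone c q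
net≡0⇒landsNone {suc n} c {suc q} (s≤s n≤q) eq = none
  where
  c₀≡0 : at (c Fin.zero) q ≡ 0
  c₀≡0 = -m+i≡0⇒m≡0 (at (c Fin.zero) q) (net≤0 (c ∘ Fin.suc) n≤q) eq
  tail≡0 : net (c ∘ Fin.suc) q ≡ 0ℤ
  tail≡0 = ≡.trans (sym (ℤₚ.+-identityˡ _))
    (subst (λ m → ℤ.- (+ m) ℤ.+ net (c ∘ Fin.suc) q ≡ 0ℤ) c₀≡0 eq)
  none : LandsNone c (suc q)
  none Fin.zero    k refl = c₀≡0
  none (Fin.suc i) k eq′  = net≡0⇒landsNone (c ∘ Fin.suc) n≤q tail≡0 i k
                              (ℕₚ.suc-injective eq′)

-- Juggling sequences in terms of net

tailJS : ∀ {a b n} (s : JugglingSequence a b (suc n)) →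
         JugglingSequence (states s (Fin.suc Fin.zero)) b n
tailJS s = record
  { states = states s ∘ Fin.suc
  ; start  = λ _ → refl
  ; end    = end s
  ; throws = throws s ∘ Fin.suc
  ; caught = caught s ∘ Fin.suc
  ; step   = step s ∘ Fin.suc
  }

first-step : ∀ {a b n} (s : JugglingSequence a b (suc n)) k →
             at (states s (Fin.suc Fin.zero)) k ≡ at a (suc k) ℤ.+ + at (throws s Fin.zero) k
first-step s k = ≡.trans (step s Fin.zero k) (cong (λ z → z ℤ.+ _) (start s (suc k)))

-- In the induction, landings of the first throws enter `net` with a minus sign and the next state
-- with a plus sign, so they cancel.
net≡start : ∀ {n a b} (s : JugglingSequence a b n) (i : Fin n) →
            net (throws s) (toℕ i) ≡ at a (toℕ i)
net≡start s Fin.zero =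
  ≡.trans (net-zero (throws s)) (≡.trans (caught s Fin.zero) (start s 0))
net≡start {a = a} s (Fin.suc i) = ≡.trans
  (cong (λ z → ℤ.- c₀ ℤ.+ z) (≡.trans (net≡start (tailJS s) i) (first-step s (toℕ i))))
  (lemma c₀ (at a (suc (toℕ i))))
  where
  c₀ = + at (throws s Fin.zero) (toℕ i)
  lemma : ∀ x y → ℤ.- x ℤ.+ (y ℤ.+ x) ≡ y
  lemma = solve-∀

-- The same cancellation at a time when nothing is thrown any more: what the initial state and the
-- landings supply at `n + k` is what the final state holds at `k`.
net≡start-end : ∀ {n a b} (s : JugglingSequence a b n) k →
                net (throws s) (n ℕ.+ k) ≡ at a (n ℕ.+ k) ℤ.- at b k
net≡start-end {zero} {a} {b} s k
  rewrite sym (start s k) | sym (end s k) = sym (ℤₚ.+-inverseʳ (at (states s Fin.zero) k))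
net≡start-end {suc n} {a} {b} s k = ≡.trans
  (cong (λ z → ℤ.- c₀ ℤ.+ z) (≡.trans (net≡start-end (tailJS s) k)
                                (cong (ℤ._- at b k) (first-step s (n ℕ.+ k)))))
  (lemma c₀ (at a (suc n ℕ.+ k)) (at b k))
  where
  c₀ = + at (throws s Fin.zero) (n ℕ.+ k)
  lemma : ∀ x y z → ℤ.- x ℤ.+ ((y ℤ.+ x) ℤ.- z) ≡ y ℤ.- z
  lemma = solve-∀

-- Reconstructing a juggling sequence from its throws

advance : State → Throws → State
advance a c = record
  { at     = λ k → at a (suc k) ℤ.+ + at c k
  ; bound  = bound a ⊔ bound c
  ; vanish = λ k b≤k → cong₂ (λ x y → x ℤ.+ + y)
      (vanish a (suc k) (ℕₚ.m≤n⇒m≤1+n (ℕₚ.≤-trans (ℕₚ.m≤m⊔n (bound a) (bound c)) b≤k)))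
      (vanish c k (ℕₚ.≤-trans (ℕₚ.m≤n⊔m (bound a) (bound c)) b≤k))
  }

run : ∀ {n} → State → Vector Throws n → Vector State (suc n)
run a c Fin.zero = a
run {suc n} a c (Fin.suc i) = run (advance a (c Fin.zero)) (c ∘ Fin.suc) i

-- Converse of `net≡start`: the condition on `net` passes to the tail, because moving the landings
-- of the first throws to the other side turns `a` into `advance a (c Fin.zero)`.
run-caught : ∀ {n} a (c : Vector Throws n) → (∀ (i : Fin n) → net c (toℕ i) ≡ at a (toℕ i)) →
             ∀ i → + total (c i) ≡ at (run a c (inject₁ i)) 0
run-caught a c eq Fin.zero    = ≡.trans (sym (net-zero c)) (eq Fin.zero)
run-caught a c eq (Fin.suc i) =
  run-caught (advance a (c Fin.zero)) (c ∘ Fin.suc) tail-eq i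
  where
  lemma : ∀ x y → y ≡ (ℤ.- x ℤ.+ y) ℤ.+ x
  lemma = solve-∀
  tail-eq : ∀ (j : Fin _) → net (c ∘ Fin.suc) (toℕ j) ≡ at (advance a (c Fin.zero)) (toℕ j)
  tail-eq j = ≡.trans (lemma (+ at (c Fin.zero) (toℕ j)) _)
                      (cong (λ z → z ℤ.+ _) (eq (Fin.suc j)))

run-step : ∀ {n} a (c : Vector Throws n) i k →
           at (run a c (Fin.suc i)) k ≡ at (run a c (inject₁ i)) (suc k) ℤ.+ + at (c i) k
run-step a c Fin.zero    k = refl
run-step a c (Fin.suc i) k = run-step (advance a (c Fin.zero)) (c ∘ Fin.suc) i k

juggle : ∀ {n} a b (c : Vector Throws n) → (∀ (i : Fin n) → net c (toℕ i) ≡ at a (toℕ i)) →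
         (∀ k → net c (n ℕ.+ k) ≡ at a (n ℕ.+ k) ℤ.- at b k) → JugglingSequence a b n
juggle {n} a b c start-eq end-eq = record
  { JugglingSequence sequence
  -- `sequence` ends in its own last state; `net≡start-end` expresses that state through `net`, and
  -- `end-eq` identifies it with `b`.
  ; end = λ k → ℤₚ.neg-injective (+-cancelˡ (at a (n ℕ.+ k)) _ _
            (≡.trans (sym (net≡start-end sequence k)) (end-eq k)))
  }
  where
  sequence : JugglingSequence a (run a c (fromℕ n)) n
  sequence = record
    { states = run a c
    ; start  = λ _ → refl
    ; end    = λ _ → refl
    ; throws = c
    ; caught = run-caught a c start-eq
    ; step   = run-step a c
    }

-- States and throws determine each other

throws-unique : ∀ {n a b} (s t : JugglingSequence a b n) →
                (∀ i → states s i ≈ₛ states t i) →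
                ∀ i k → at (throws s i) k ≡ at (throws t i) k
throws-unique s t eq i k = ℤₚ.+-injective (+-cancelˡ (at (states s (inject₁ i)) (suc k)) _ _
  (begin
    at (states s (inject₁ i)) (suc k) ℤ.+ + at (throws s i) k  ≡⟨ step s i k ⟨
    at (states s (Fin.suc i)) k                                ≡⟨ eq (Fin.suc i) k ⟩
    at (states t (Fin.suc i)) k                                ≡⟨ step t i k ⟩
    at (states t (inject₁ i)) (suc k) ℤ.+ + at (throws t i) k
      ≡⟨ cong (λ z → z ℤ.+ _) (eq (inject₁ i) (suc k)) ⟨
    at (states s (inject₁ i)) (suc k) ℤ.+ + at (throws t i) k  ∎))

states-unique : ∀ {n a b} (s t : JugglingSequence a b n) →
                (∀ i k → at (throws s i) k ≡ at (throws t i) k) →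
                ∀ i → states s i ≈ₛ states t i
states-unique s t eq Fin.zero k = ≡.trans (start s k) (sym (start t k))
states-unique {suc n} {a} s t eq (Fin.suc i) =
  states-unique (tailJS s) tail-t (eq ∘ Fin.suc) i
  where
  -- The induction compares sequences with a common start, so the tail of `t` is given the second
  -- state of `s` as its start; the two second states agree because the first throws do.
  tail-t : JugglingSequence (states s (Fin.suc Fin.zero)) _ n
  tail-t = record
    { JugglingSequence (tailJS t)
    ; start = λ k → ≡.trans (first-step t k)
        (≡.trans (cong (λ m → at a (suc k) ℤ.+ + m) (sym (eq Fin.zero k))) (sym (first-step s k)))
    }

-- Roots of a family of throws

rootRow : ∀ d → ℕ → Throws → List (Vec ℤ d)
rootRow d t c = concat (applyUpTo (λ j →
  List.replicate (at c j) (root t (t ℕ.+ suc j))) (bound c))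

-- Agrees definitionally with `throwRoots` on the throws of a juggling sequence, but is available
-- before a family of throws is known to come from one.
rootList : ∀ d {n} → Vector Throws n → List (Vec ℤ d)
rootList d {n} c = concatMap (λ i → rootRow d (toℕ i) (c i)) (allFin n)

module _ {d} (w : Vec ℤ d → ℤ) where

  weight-rootRow : ∀ t c → weight w (rootRow d t c)
    ≡ sum {bound c} (λ j → + at c (toℕ j) ℤ.* w (root t (t ℕ.+ suc (toℕ j))))
  weight-rootRow t c = ≡.trans (weight-concat-applyUpTo w _ (bound c))
    (sum-cong-≗ {bound c} λ j → weight-replicate w (at c (toℕ j)) (root t (t ℕ.+ suc (toℕ j))))

  weight-rootList : ∀ {n} (c : Vector Throws n) →
    weight w (rootList d c) ≡ sum (λ i → weight w (rootRow d (toℕ i) (c i)))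
  weight-rootList c = weight-concatMap-tabulate w (λ i → rootRow d (toℕ i) (c i)) id

+total≡sum : ∀ c → + total c ≡ sum {bound c} (λ j → + at c (toℕ j))
+total≡sum c = go (at c) (bound c)
  where
  go : ∀ f b → + ListAction.sum (applyUpTo f b) ≡ sum {b} (λ j → + f (toℕ j))
  go f zero    = refl
  go f (suc b) = ≡.trans (ℤₚ.pos-+ (f 0) _) (cong (λ z → + f 0 ℤ.+ z) (go (f ∘ suc) b))

-- At `q = t` every root contributes 1; at a later `q` only the height landing there contributes,
-- with sign -1. Positive `t` reduces to `t = 0` by shifting the indices of `δ`, and coordinate 0
-- then receives nothing.
sum-δ≡leaving : ∀ t c q →
  sum {bound c} (λ j → + at c (toℕ j) ℤ.* (δ q t ℤ.- δ q (t ℕ.+ suc (toℕ j))))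
  ≡ leaving t c q
sum-δ≡leaving zero c zero =
  ≡.trans (sum-cong-≗ {bound c} λ j → ℤₚ.*-identityʳ (+ at c (toℕ j))) (sym (+total≡sum c))
sum-δ≡leaving zero c (suc k) = ≡.trans
  (sum-single-toℕ {bound c} f k off (λ b≤k → cong (λ m → + m ℤ.* _) (vanish c k b≤k)))
  on
  where
  f : ℕ → ℤ
  f j = + at c j ℤ.* (0ℤ ℤ.- δ k j)
  off : ∀ j → j ≢ k → f j ≡ 0ℤ
  off j j≢k rewrite δ-≢ (j≢k ∘ sym) = ℤₚ.*-zeroʳ (+ at c j)
  lemma : ∀ x → x ℤ.* (0ℤ ℤ.- 1ℤ) ≡ ℤ.- x
  lemma = solve-∀
  on : f k ≡ ℤ.- (+ at c k)
  on rewrite δ-refl k = lemma (+ at c k)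
sum-δ≡leaving (suc t) c zero    = sum-zero {bound c} λ j → ℤₚ.*-zeroʳ (+ at c (toℕ j))
sum-δ≡leaving (suc t) c (suc q) = sum-δ≡leaving t c q

-- The bridge between the two sides: the juggling conditions, phrased through `net`, become
-- conditions on the sum of the roots.
lookup-sumV-rootList : ∀ {d n} (c : Vector Throws n) (q : Fin d) →
                       lookup (sumV (rootList d c)) q ≡ net c (toℕ q)
lookup-sumV-rootList {d} c q = ≡.trans (lookup-sumV q (rootList d c))
  (≡.trans (weight-rootList _ c) (sum-cong-≗ λ i → ≡.trans (weight-rootRow _ (toℕ i) (c i))
    (≡.trans (sum-cong-≗ {bound (c i)} λ j → cong (+ at (c i) (toℕ j) ℤ.*_) (lookup-root q (toℕ i) _))
             (sum-δ≡leaving (toℕ i) (c i) (toℕ q)))))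

-- Multiplicities of positive roots as numbers of throws

_≟ᵥ_ : ∀ {d} → DecidableEquality (Vec ℤ d)
_≟ᵥ_ = Vecₚ.≡-dec ℤₚ._≟_

multiplicity : ∀ {d} → Vec ℤ d → List (Vec ℤ d) → ℕ
multiplicity = count _≟ᵥ_

module _ {r : ℕ} where

  throw-injective : ∀ (i : Fin r) k {i′ j′} → toℕ i ℕ.+ suc k ≤ r →
    root {suc r} (toℕ i) (toℕ i ℕ.+ suc k) ≡ root i′ j′ →
    toℕ i ≡ i′ × toℕ i ℕ.+ suc k ≡ j′
  throw-injective i k {i′} {j′} land≤r eq =
    subst (_≡ i′) i≡ (proj₁ indices) , subst (_≡ j′) j≡ (proj₂ indices)
    where
    I J : Fin (suc r)
    I = inject₁ i
    J = fromℕ< (s≤s land≤r)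
    i≡ : toℕ I ≡ toℕ i
    i≡ = Finₚ.toℕ-inject₁ i
    j≡ : toℕ J ≡ toℕ i ℕ.+ suc k
    j≡ = Finₚ.toℕ-fromℕ< (s≤s land≤r)
    indices : toℕ I ≡ i′ × toℕ J ≡ j′
    indices = root-injective I J
      (≡.subst₂ _<_ (sym i≡) (sym j≡) (ℕₚ.m<m+n (toℕ i) (s≤s z≤n)))
      (≡.trans (cong₂ root i≡ j≡) eq)

  throw-positive : ∀ (i : Fin r) k → toℕ i ℕ.+ suc k ≤ r →
                   IsPositiveRoot r (root (toℕ i) (toℕ i ℕ.+ suc k))
  throw-positive i k land≤r = inject₁ i , J ,
    ≡.subst₂ _<_ (sym i≡) (sym j≡) (ℕₚ.m<m+n (toℕ i) (s≤s z≤n)) ,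
    sym (cong₂ root i≡ j≡)
    where
    J = fromℕ< (s≤s land≤r)
    i≡ = Finₚ.toℕ-inject₁ i
    j≡ = Finₚ.toℕ-fromℕ< (s≤s land≤r)

  positive⇒throw : ∀ {v} → IsPositiveRoot r v → ∃[ i ] ∃[ k ]
    (toℕ {r} i ℕ.+ suc k ≤ r × v ≡ root (toℕ i) (toℕ i ℕ.+ suc k))
  positive⇒throw (i , j , i<j , refl) =
    -- Time `i` is one of the `r` throw times because `i < j` and `j ≤ r`. The height is `j - i`,
    -- and its index is one less.
    I , toℕ j ℕ.∸ suc (toℕ i) , subst (_≤ r) j≡ j≤r , cong₂ root (sym i≡) j≡
    where
    j≤r : toℕ j ≤ r
    j≤r = ℕ.s≤s⁻¹ (Finₚ.toℕ<n j)
    I : Fin r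
    I = fromℕ< (ℕₚ.<-≤-trans i<j j≤r)
    i≡ : toℕ I ≡ toℕ i
    i≡ = Finₚ.toℕ-fromℕ< _
    j≡ : toℕ j ≡ toℕ I ℕ.+ suc (toℕ j ℕ.∸ suc (toℕ i))
    j≡ rewrite i≡ = sym (≡.trans (ℕₚ.+-suc (toℕ i) _) (ℕₚ.m+[n∸m]≡n i<j))

  -- If `root i j` were a root with valid indices `i′` and `j′`, injectivity would force `j = j′`,
  -- which is at most `r`.
  ¬positive : ∀ {i j} → r < j → ¬ IsPositiveRoot r (root i j)
  ¬positive {i} {j} r<j (i′ , j′ , i′<j′ , eq) = ℕₚ.<⇒≱ r<j
    (subst (_≤ r) (proj₂ (root-injective i′ j′ {i} {j} i′<j′ (sym eq))) (ℕ.s≤s⁻¹ (Finₚ.toℕ<n j′)))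

  -- By `throw-injective` no other pair of time and height yields this root, so only the cell of `i`
  -- and `k` contributes.
  multiplicity-rootList : ∀ (c : Vector Throws r) i k → toℕ i ℕ.+ suc k ≤ r →
    multiplicity (root (toℕ i) (toℕ i ℕ.+ suc k)) (rootList (suc r) c) ≡ at (c i) k
  multiplicity-rootList c i k land≤r = ℤₚ.+-injective (begin
    + multiplicity v (rootList (suc r) c)               ≡⟨ +count≡weight _≟ᵥ_ v (rootList (suc r) c) ⟩
    weight w (rootList (suc r) c)                       ≡⟨ weight-rootList w c ⟩
    sum (λ t → weight w (rootRow (suc r) (toℕ t) (c t)))  ≡⟨ sum-single i other-time ⟩
    weight w (rootRow (suc r) (toℕ i) (c i))            ≡⟨ weight-rootRow w (toℕ i) (c i) ⟩
    sum {bound (c i)} (f i ∘ toℕ)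
      ≡⟨ sum-single-toℕ {bound (c i)} (f i) k other-height
           (λ b≤k → cong (λ m → + m ℤ.* w v) (vanish (c i) k b≤k)) ⟩
    + at (c i) k ℤ.* w v
      ≡⟨ cong (λ m → + at (c i) k ℤ.* + m) (indicator-refl _≟ᵥ_ v) ⟩
    + at (c i) k ℤ.* 1ℤ                                 ≡⟨ ℤₚ.*-identityʳ _ ⟩
    + at (c i) k                                        ∎)
    where
    v : Vec ℤ (suc r)
    v = root (toℕ i) (toℕ i ℕ.+ suc k)
    w : Vec ℤ (suc r) → ℤ
    w = +_ ∘ indicator _≟ᵥ_ v
    f : Fin r → ℕ → ℤ
    f t j = + at (c t) j ℤ.* w (root (toℕ t) (toℕ t ℕ.+ suc j))
    f≡0 : ∀ t j → v ≢ root (toℕ t) (toℕ t ℕ.+ suc j) → f t j ≡ 0ℤ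
    f≡0 t j v≢ rewrite indicator-≢ _≟ᵥ_ v≢ = ℤₚ.*-zeroʳ (+ at (c t) j)
    other-time : ∀ t → t ≢ i → weight w (rootRow (suc r) (toℕ t) (c t)) ≡ 0ℤ
    other-time t t≢i = ≡.trans (weight-rootRow w (toℕ t) (c t))
      (sum-zero {bound (c t)} λ j → f≡0 t (toℕ j) λ eq →
        t≢i (Finₚ.toℕ-injective (sym (proj₁ (throw-injective i k {toℕ t} {toℕ t ℕ.+ suc (toℕ j)} land≤r eq)))))
    other-height : ∀ j → j ≢ k → f i j ≡ 0ℤ
    other-height j j≢k = f≡0 i j λ eq → j≢k (sym (ℕₚ.suc-injective
      (ℕₚ.+-cancelˡ-≡ (toℕ i) _ _ (proj₂ (throw-injective i k {toℕ i} {toℕ i ℕ.+ suc j} land≤r eq)))))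

  -- Zero-based time `r` is the last coordinate; a later landing would leave the bare vector `ε i`,
  -- which is not a positive root.
  Within : Vector Throws r → Set
  Within c = ∀ i k → r < toℕ i ℕ.+ suc k → at (c i) k ≡ 0

  rootList-positive : ∀ (c : Vector Throws r) → Within c →
                      All (IsPositiveRoot r) (rootList (suc r) c)
  rootList-positive c within = Allₚ.concat⁺ (Allₚ.map⁺ (Allₚ.tabulate⁺ λ i →
    Allₚ.concat⁺ (Allₚ.applyUpTo⁺₂ _ (bound (c i)) (cell i))))
    where
    cell : ∀ i j → All (IsPositiveRoot r)
             (List.replicate (at (c i) j) (root (toℕ i) (toℕ i ℕ.+ suc j)))
    cell i j with toℕ i ℕ.+ suc j ℕₚ.≤? r
    ... | yes land≤r = Allₚ.replicate⁺ (at (c i) j) (throw-positive i j land≤r)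
    ... | no  land≰r rewrite within i j (ℕₚ.≰⇒> land≰r) = []

  -- Every positive root belongs to a throw landing by `r`, so agreement on those throws settles all
  -- multiplicities that matter.
  rootList-↭ : ∀ (c : Vector Throws r) → Within c → ∀ {vs} → All (IsPositiveRoot r) vs →
    (∀ i k → toℕ i ℕ.+ suc k ≤ r →
      at (c i) k ≡ multiplicity (root (toℕ i) (toℕ i ℕ.+ suc k)) vs) →
    rootList (suc r) c ↭ vs
  rootList-↭ c within {vs} pos eq =
    count⇒↭ _≟ᵥ_ (rootList-positive c within) pos same
    where
    same : ∀ v → IsPositiveRoot r v → multiplicity v (rootList (suc r) c) ≡ multiplicity v vs
    same v pv with i , k , land≤r , refl ← positive⇒throw pv =
      ≡.trans (multiplicity-rootList c i k land≤r) (eq i k land≤r)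

-- Finiteness of root multisets

-- The coefficient `- q` makes this linear form send `ε i - ε j` to `j - i`, the usual height of a
-- root in terms of simple roots.
height : ∀ {d} → Vec ℤ d → ℤ
height v = sum λ q → ℤ.- (+ toℕ q) ℤ.* lookup v q

height-⊕ : ∀ {d} (v w : Vec ℤ d) → height (v ⊕ w) ≡ height v ℤ.+ height w
height-⊕ v w = ≡.trans
  (sum-cong-≗ λ q → ≡.trans (cong (ℤ.- (+ toℕ q) ℤ.*_) (Vecₚ.lookup-zipWith ℤ._+_ q v w))
                            (ℤₚ.*-distribˡ-+ (ℤ.- (+ toℕ q)) (lookup v q) (lookup w q)))
  (∑-distrib-+ (λ q → ℤ.- (+ toℕ q) ℤ.* lookup v q) _)

height-root : ∀ {d} (i j : Fin d) → height (root {d} (toℕ i) (toℕ j)) ≡ + toℕ j ℤ.- + toℕ i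
height-root {d} i j = begin
  height (root {d} (toℕ i) (toℕ j))
    ≡⟨ sum-cong-≗ {d} (λ q → ≡.trans (cong (ℤ.- (+ toℕ q) ℤ.*_) (lookup-root q (toℕ i) (toℕ j)))
                                  (split (+ toℕ q) (δ (toℕ q) (toℕ i)) (δ (toℕ q) (toℕ j)))) ⟩
  sum (λ q → f j q ℤ.+ ℤ.- 1ℤ ℤ.* f i q)
    ≡⟨ ∑-distrib-+ (f j) _ ⟩
  sum (f j) ℤ.+ sum (λ q → ℤ.- 1ℤ ℤ.* f i q)
    ≡⟨ cong₂ ℤ._+_ (sum-single j (off j))
         (sum-single i λ q q≢i → cong (ℤ.- 1ℤ ℤ.*_) (off i q q≢i)) ⟩
  f j j ℤ.+ ℤ.- 1ℤ ℤ.* f i i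
    ≡⟨ cong₂ (λ x y → x ℤ.+ ℤ.- 1ℤ ℤ.* y) (on j) (on i) ⟩
  + toℕ j ℤ.+ ℤ.- 1ℤ ℤ.* + toℕ i
    ≡⟨ cong (λ z → + toℕ j ℤ.+ z) (ℤₚ.-1*i≡-i (+ toℕ i)) ⟩
  + toℕ j ℤ.- + toℕ i ∎
  where
  f : Fin d → Fin d → ℤ
  f p q = + toℕ q ℤ.* δ (toℕ q) (toℕ p)
  off : ∀ p q → q ≢ p → f p q ≡ 0ℤ
  off p q q≢p rewrite δ-≢ (q≢p ∘ Finₚ.toℕ-injective) = ℤₚ.*-zeroʳ (+ toℕ q)
  on : ∀ p → f p p ≡ + toℕ p
  on p rewrite δ-refl (toℕ p) = ℤₚ.*-identityʳ (+ toℕ p)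
  split : ∀ x y z → ℤ.- x ℤ.* (y ℤ.- z) ≡ x ℤ.* z ℤ.+ ℤ.- 1ℤ ℤ.* (x ℤ.* y)
  split = solve-∀

1≤height : ∀ {r v} → IsPositiveRoot r v → 1ℤ ℤ.≤ height v
1≤height (i , j , i<j , refl) = subst (1ℤ ℤ.≤_) (sym (height-root i j))
  (subst (1ℤ ℤ.≤_) (sym (≡.trans (ℤₚ.[+m]-[+n]≡m⊖n (toℕ j) (toℕ i)) (ℤₚ.⊖-≥ (ℕₚ.<⇒≤ i<j))))
     (ℤ.+≤+ (ℕₚ.m<n⇒0<n∸m i<j)))

length≤height : ∀ {r vs} → All (IsPositiveRoot r) vs → + length vs ℤ.≤ height (sumV vs)
length≤height {r} [] = ℤₚ.≤-reflexive (sym (sum-zero {suc r} λ q →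
  ≡.trans (cong (ℤ.- (+ toℕ q) ℤ.*_) (Vecₚ.lookup-replicate q 0ℤ)) (ℤₚ.*-zeroʳ (ℤ.- (+ toℕ q)))))
length≤height {vs = v ∷ vs} (pv ∷ pvs) = subst (+ length (v ∷ vs) ℤ.≤_)
  (sym (height-⊕ v (sumV vs))) (ℤₚ.+-mono-≤ (1≤height pv) (length≤height pvs))

-- Bounded lists and cardinalities from enumerations

listsUpTo : ∀ {A : Set} → List A → ℕ → List (List A)
listsUpTo as zero    = [] ∷ []
listsUpTo as (suc n) = [] ∷ cartesianProductWith _∷_ as (listsUpTo as n)

∈-listsUpTo : ∀ {A : Set} {as : List A} {n xs} → All (_∈ as) xs → length xs ≤ n →
              xs ∈ listsUpTo as n
∈-listsUpTo {n = zero}  []         z≤n     = here refl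
∈-listsUpTo {n = suc n} []         z≤n     = here refl
∈-listsUpTo {n = suc n} (x∈ ∷ xs∈) (s≤s p) =
  there (∈-cartesianProductWith⁺ _∷_ x∈ (∈-listsUpTo xs∈ p))

module _ (S : DecSetoid 0ℓ 0ℓ) where
  open DecSetoid S using (_≈_; _≟_; setoid)

  unique⇒lookup-injective : ∀ {xs} → Unique setoid xs → ∀ {i j} →
    List.lookup xs i ≈ List.lookup xs j → i ≡ j
  unique⇒lookup-injective (x∉ ∷ u) {Fin.zero}  {Fin.zero}  eq = refl
  unique⇒lookup-injective (x∉ ∷ u) {Fin.zero}  {Fin.suc j} eq =
    contradiction eq (All.lookup x∉ (∈-lookup j))
  unique⇒lookup-injective (x∉ ∷ u) {Fin.suc i} {Fin.zero}  eq =
    contradiction (DecSetoid.sym S eq) (All.lookup x∉ (∈-lookup i))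
  unique⇒lookup-injective (x∉ ∷ u) {Fin.suc i} {Fin.suc j} eq =
    cong Fin.suc (unique⇒lookup-injective u eq)

  -- Repetitions up to `≈` are removed first, so that indexing into the remaining list is injective;
  -- the enumeration makes it surjective.
  enumeration⇒cardinality : ∀ {xs} → IsEnumeration setoid xs → ∃[ m ] HasCardinality setoid m
  enumeration⇒cardinality {xs} enum = length ys , record
    { to        = List.lookup ys
    ; cong      = λ where refl → DecSetoid.refl S
    ; bijective = unique⇒lookup-injective (deduplicate-! S xs)
                , lookup-surjective setoid (deduplicate⁺ S enum)
    }
    where ys = deduplicate _≟_ xs

module _ (r : ℕ) (μ : Vec ℤ (suc r)) where

  P-decSetoid : DecSetoid 0ℓ 0ℓ
  P-decSetoid = record
    { isDecEquivalence = record
      { isEquivalence = Setoid.isEquivalence (P r μ)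
      ; _≟_           = λ x y → _↭?_ _≟ᵥ_ (roots x) (roots y)
      }
    }

  positive? : ∀ v → Dec (IsPositiveRoot r v)
  positive? v = Finₚ.any? λ i → Finₚ.any? λ j → (i Finₚ.<? j) ×-dec (v ≟ᵥ root (toℕ i) (toℕ j))

  toMultiset : List (Vec ℤ (suc r)) → Maybe (RootMultiset r μ)
  toMultiset vs with All.all? positive? vs | sumV vs ≟ᵥ μ
  ... | yes pos | yes eq = just (record { roots = vs ; positive = pos ; sums = eq })
  ... | _       | _      = nothing

  -- The record that comes back carries freshly decided proofs, so it is compared with `x` through
  -- the list of roots alone, as in `P`.
  toMultiset-roots : ∀ x → MAny.Any (λ y → roots x ↭ roots y) (toMultiset (roots x))
  toMultiset-roots x with All.all? positive? (roots x) | sumV (roots x) ≟ᵥ μ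
  ... | yes _   | yes _  = just refl
  ... | yes _   | no neq = contradiction (sums x) neq
  ... | no ¬pos | _      = contradiction (positive x) ¬pos

  differences : List (Vec ℤ (suc r))
  differences = cartesianProductWith (λ i j → root (toℕ i) (toℕ j))
                  (allFin (suc r)) (allFin (suc r))

  candidates : List (List (Vec ℤ (suc r)))
  candidates = listsUpTo differences ∣ height μ ∣

  roots∈candidates : ∀ (x : RootMultiset r μ) → roots x ∈ candidates
  roots∈candidates x = ∈-listsUpTo (All.map positive⇒∈ (positive x)) length≤
    where
    positive⇒∈ : ∀ {v} → IsPositiveRoot r v → v ∈ differences
    positive⇒∈ (i , j , _ , refl) = ∈-cartesianProductWith⁺ _ (∈-allFin i) (∈-allFin j)
    bound≤ : + length (roots x) ℤ.≤ height μ
    bound≤ = subst (λ v → + length (roots x) ℤ.≤ height v) (sums x) (length≤height (positive x))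
    length≤ : length (roots x) ≤ ∣ height μ ∣
    -- The existence of `x` forces `height μ` to be nonnegative, so the absolute value in
    -- `candidates` is the height itself.
    length≤ = ℤₚ.drop‿+≤+ (subst (+ length (roots x) ℤ.≤_)
      (sym (ℤₚ.0≤i⇒+∣i∣≡i (ℤₚ.≤-trans (ℤ.+≤+ z≤n) bound≤))) bound≤)

  P-enumeration : IsEnumeration (P r μ) (mapMaybe toMultiset candidates)
  P-enumeration x = Anyₚ.mapMaybe⁺ toMultiset candidates (Anyₚ.map⁺
    (Any.map (λ where refl → toMultiset-roots x) (roots∈candidates x)))

  P-finite : ∃[ m ] (K[ r , μ ]≡ m)
  P-finite = enumeration⇒cardinality P-decSetoid P-enumeration

-- The bijection

lookup≡entry : ∀ {n} (xs : Vec ℤ n) q → lookup xs q ≡ entry xs (toℕ q)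
lookup≡entry (x ∷ xs) Fin.zero    = refl
lookup≡entry (x ∷ xs) (Fin.suc q) = lookup≡entry xs q

entry-init : ∀ {n} (xs : Vec ℤ (suc n)) (i : Fin n) →
             entry (init xs) (toℕ i) ≡ entry xs (toℕ i)
entry-init (x ∷ y ∷ xs) Fin.zero    = refl
entry-init (x ∷ y ∷ xs) (Fin.suc i) = entry-init (y ∷ xs) i

sumℤ-init : ∀ {n} (xs : Vec ℤ (suc n)) → sumℤ xs ≡ sumℤ (init xs) ℤ.+ entry xs n
sumℤ-init (x ∷ []) = ℤₚ.+-comm x 0ℤ
sumℤ-init (x ∷ y ∷ xs) =
  ≡.trans (cong (λ z → x ℤ.+ z) (sumℤ-init (y ∷ xs))) (sym (ℤₚ.+-assoc x _ _))

module _ (r : ℕ) (μ : Vec ℤ (suc r)) (sum≡0 : sumℤ μ ≡ 0ℤ) where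

  private
    a b : State
    a = ⟨ init μ ⟩
    b = ⟨ sumℤ (init μ) ∷ [] ⟩

  -- Here the zero-sum hypothesis enters: it matches the last coordinate of `μ` with the value that
  -- `net-end` gives at time `r`.
  last≡ : entry μ r ≡ ℤ.- sumℤ (init μ)
  last≡ = begin
    entry μ r                                          ≡⟨ lemma (sumℤ (init μ)) (entry μ r) ⟩
    (sumℤ (init μ) ℤ.+ entry μ r) ℤ.- sumℤ (init μ)    ≡⟨ cong (ℤ._- sumℤ (init μ)) (sumℤ-init μ) ⟨
    sumℤ μ ℤ.- sumℤ (init μ)                           ≡⟨ cong (ℤ._- sumℤ (init μ)) sum≡0 ⟩
    0ℤ ℤ.- sumℤ (init μ)                               ≡⟨ ℤₚ.+-identityˡ _ ⟩
    ℤ.- sumℤ (init μ)                                  ∎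
    where
    lemma : ∀ x y → y ≡ (x ℤ.+ y) ℤ.- x
    lemma = solve-∀

  start-vanish : ∀ k → at a (r ℕ.+ k) ≡ 0ℤ
  start-vanish k = entry-vanish (init μ) (r ℕ.+ k) (ℕₚ.m≤m+n r k)

  net-end : (s : JugglingSequence a b r) → ∀ k → net (throws s) (r ℕ.+ k) ≡ ℤ.- at b k
  net-end s k = ≡.trans (net≡start-end s k)
    (≡.trans (cong (ℤ._- at b k) (start-vanish k)) (ℤₚ.+-identityˡ _))

  -- Past time `r` neither `a` nor `b` has a nonzero entry, so `net` vanishes there and no throw can
  -- land.
  throws-within : (s : JugglingSequence a b r) → Within (throws s)
  throws-within s i k r<q = net≡0⇒landsNone (throws s) (ℕₚ.m≤m+n r (suc m))
    (net-end s (suc m)) i k (sym (≡.trans (ℕₚ.+-suc r m) (ℕₚ.m+[n∸m]≡n r<q)))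
    -- Chosen so that `r + suc m` is the landing time.
    where m = toℕ i ℕ.+ suc k ℕ.∸ suc r

  net≡μ : (s : JugglingSequence a b r) → ∀ q → q ≤ r → net (throws s) q ≡ entry μ q
  net≡μ s q q≤r with ℕₚ.m≤n⇒m<n∨m≡n q≤r
  ... | inj₁ q<r = subst (λ q → net (throws s) q ≡ entry μ q) (Finₚ.toℕ-fromℕ< q<r)
                     (≡.trans (net≡start s (fromℕ< q<r)) (entry-init μ (fromℕ< q<r)))
  ... | inj₂ refl = ≡.trans (cong (net (throws s)) (sym (ℕₚ.+-identityʳ r)))
                     (≡.trans (net-end s 0) (sym last≡))

  toRoots : JugglingSequence a b r → RootMultiset r μ
  toRoots s = record
    { roots    = throwRoots (suc r) s
    ; positive = rootList-positive (throws s) (throws-within s)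
    ; sums     = lookup-ext λ q → begin
        lookup (sumV (throwRoots (suc r) s)) q  ≡⟨ lookup-sumV-rootList (throws s) q ⟩
        net (throws s) (toℕ q)                  ≡⟨ net≡μ s (toℕ q) (ℕ.s≤s⁻¹ (Finₚ.toℕ<n q)) ⟩
        entry μ (toℕ q)                         ≡⟨ lookup≡entry μ q ⟨
        lookup μ q                              ∎
    }

  toRoots-cong : ∀ s t → (∀ i → states s i ≈ₛ states t i) →
                 roots (toRoots s) ↭ roots (toRoots t)
  toRoots-cong s t eq = rootList-↭ (throws s) (throws-within s) (positive (toRoots t))
    λ i k land≤r → ≡.trans (throws-unique s t eq i k)
                           (sym (multiplicity-rootList (throws t) i k land≤r))

  -- Multiplicities recover the throws landing by `r`, and later landings are absent from both
  -- sequences; the throws then determine the states.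
  toRoots-injective : ∀ s t → roots (toRoots s) ↭ roots (toRoots t) →
                      ∀ i → states s i ≈ₛ states t i
  toRoots-injective s t p = states-unique s t same
    where
    same : ∀ i k → at (throws s i) k ≡ at (throws t i) k
    same i k with toℕ i ℕ.+ suc k ℕₚ.≤? r
    ... | yes land≤r = ≡.trans (sym (multiplicity-rootList (throws s) i k land≤r))
                         (≡.trans (count-↭ _≟ᵥ_ _ p) (multiplicity-rootList (throws t) i k land≤r))
    ... | no land≰r = ≡.trans (throws-within s i k (ℕₚ.≰⇒> land≰r))
                        (sym (throws-within t i k (ℕₚ.≰⇒> land≰r)))

  module _ (x : RootMultiset r μ) where

    throwsOf : Vector Throws r
    throwsOf i = record
      { at     = λ k → multiplicity (root (toℕ i) (toℕ i ℕ.+ suc k)) (roots x)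
      -- A throw with height index at least `r` lands after `r` whatever its time, so one bound
      -- serves all times.
      ; bound  = r
      ; vanish = λ k r≤k → count-All _≟ᵥ_
          (¬positive {i = toℕ i} (ℕₚ.≤-trans (s≤s r≤k) (ℕₚ.m≤n+m (suc k) (toℕ i)))) (positive x)
      }

    throwsOf-within : Within throwsOf
    throwsOf-within i k r<q = count-All _≟ᵥ_ (¬positive {i = toℕ i} r<q) (positive x)

    rootList-throwsOf : rootList (suc r) throwsOf ↭ roots x
    rootList-throwsOf = rootList-↭ throwsOf throwsOf-within (positive x) λ i k _ → refl

    -- The list rebuilt from `throwsOf` is a permutation of `roots x`, so it has the same sum `μ`.
    net-throwsOf : ∀ q → q < suc r → net throwsOf q ≡ entry μ q
    net-throwsOf q q<d = subst (λ q → net throwsOf q ≡ entry μ q) (Finₚ.toℕ-fromℕ< q<d) (begin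
      net throwsOf (toℕ Q)                          ≡⟨ lookup-sumV-rootList throwsOf Q ⟨
      lookup (sumV (rootList (suc r) throwsOf)) Q   ≡⟨ lookup-sumV Q (rootList (suc r) throwsOf) ⟩
      weight (λ v → lookup v Q) (rootList (suc r) throwsOf)
        ≡⟨ weight-↭ _ rootList-throwsOf ⟩
      weight (λ v → lookup v Q) (roots x)           ≡⟨ lookup-sumV Q (roots x) ⟨
      lookup (sumV (roots x)) Q                     ≡⟨ cong (λ v → lookup v Q) (sums x) ⟩
      lookup μ Q                                    ≡⟨ lookup≡entry μ Q ⟩
      entry μ (toℕ Q)                               ∎)
      where Q = fromℕ< q<d

    fromRoots : JugglingSequence a b r
    fromRoots = juggle a b throwsOf
      (λ i → ≡.trans (net-throwsOf (toℕ i) (ℕₚ.m≤n⇒m≤1+n (Finₚ.toℕ<n i))) (sym (entry-init μ i)))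
      λ k → ≡.trans (net-after k) (sym (≡.trans (cong (ℤ._- at b k) (start-vanish k))
                                                (ℤₚ.+-identityˡ _)))
      where
      net-after : ∀ k → net throwsOf (r ℕ.+ k) ≡ ℤ.- at b k
      -- Time `r` is the last coordinate, balanced by the entry of `b`; afterwards no throw lands
      -- and `b` is zero.
      net-after zero rewrite ℕₚ.+-identityʳ r = ≡.trans (net-throwsOf r ℕₚ.≤-refl) last≡
      net-after (suc k) = landsNone⇒net≡0 throwsOf (ℕₚ.m≤m+n r (suc k)) λ i j eq →
        throwsOf-within i j (subst (r <_) (sym eq) (ℕₚ.m<m+n r (s≤s z≤n)))

  JS⤖P : Bijection (JS a b r) (P r μ)
  JS⤖P = record
    { to        = toRoots
    ; cong      = λ {s} {t} → toRoots-cong s t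
    ; bijective = (λ {s} {t} → toRoots-injective s t)
                -- Surjectivity is asked for every `s` with the same states as `fromRoots x`;
                -- `toRoots-cong` passes to `fromRoots x` itself, whose throws compute to
                -- `throwsOf x`.
                , λ x → fromRoots x , λ {s} s≈ →
                    ↭-trans (toRoots-cong s (fromRoots x) s≈) (rootList-throwsOf x)
    }

mainTheorem4 : (r : ℕ) → 1 ≤ r → (μ : Vec ℤ (suc r)) → sumℤ μ ≡ 0ℤ →
    let a = ⟨ init μ ⟩
        b = ⟨ sumℤ (init μ) ∷ [] ⟩
    in (Σ (Bijection (JS a b r) (P r μ)) λ f →
          ∀ s → roots (Bijection.to f s) ↭ throwRoots (suc r) s)
       × (∃[ m ] ((K[ r , μ ]≡ m) × (js[ a , b , r ]≡ m)))
mainTheorem4 r _ μ sum≡0 =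
  -- The list in `toRoots s` is `throwRoots (suc r) s` by definition, so reflexivity suffices.
  (JS⤖P r μ sum≡0 , λ _ → ↭-refl) ,
  -- The cardinality is found for root multisets and carried to juggling sequences by the inverse
  -- bijection.
  proj₁ (P-finite r μ) , K≡ , Bijectionₚ.trans K≡ P⤖JS
  where
  K≡ = proj₂ (P-finite r μ)
  P⤖JS = Inverseₚ.Inverse⇒Bijection
            (Inverseₚ.sym (Bijectionₚ.Bijection⇒Inverse (JS⤖P r μ sum≡0)))
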